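{- Let $G=(V,E,\Sigma,\lambda)$ be a labeled directed graph and let $\mathcal{G}=(N,\Sigma,P,S)$ be a linear context-free grammar in terminal-anchored linear normal form (TALNF) over the same alphabet. Run the algorithm LinIndex-Build (defined in the context) on $(G,\mathcal{G})$, and let $\{M_A\}_{A\in N}$ be the Boolean matrices at termination. Then the algorithm computes the relations $\mathcal{R}_A$ exactly: for all $A\in N$ and all $u,v\in V$, \[ M_A[u,v]=1\iff (u,v)\in\mathcal{R}_A . \]
   Context: A labeled directed graph is $G=(V,E,\Sigma,\lambda)$ with $V$ a finite set of vertices, $E\subseteq V\times V$ the directed edges, $\Sigma$ a finite alphabet, and $\lambda:E\to\Sigma$ a labeling of the edges. A path $\pi$ from $v_0$ to $v_k$ is a (possibly empty) sequence of edges $(v_0,v_1)\cdots(v_{k-1},v_k)$; the empty path at $u$ goes from $u$ to $u$. The trace is $\operatorname{tr}(\pi)=\lambda(v_0,v_1)\cdots\lambda(v_{k-1},v_k)\in\Sigma^*$. A context-free grammar is $\mathcal{G}=(N,\Sigma,P,S)$ with finite nonterminal set $N$, terminals $\Sigma$, productions $P$, start symbol $S\in N$; $\mathcal{L}_{\mathcal{G}}(A)\subseteq\Sigma^*$ is the language generated from $A\in N$. It is in TALNF if each production is one of $A\to a$, $A\to aB$, $A\to Ba$, or $S\to\varepsilon$, with $a\in\Sigma$ and $A,B\in N$. For $A\in N$, $\mathcal{R}_A\subseteq V\times V$ is defined by $(u,v)\in\mathcal{R}_A$ iff there is a path $\pi$ from $u$ to $v$ with $\operatorname{tr}(\pi)\in\mathcal{L}_{\mathcal{G}}(A)$.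 For $a\in\Sigma$ let $\mathrm{In}_a(v)=\{u\in V:(u,v)\in E,\ \lambda(u,v)=a\}$ and $\mathrm{Out}_a(u)=\{v\in V:(u,v)\in E,\ \lambda(u,v)=a\}$. Algorithm LinIndex-Build$(G,\mathcal{G})$. Maintain matrices $M_A\in\{0,1\}^{V\times V}$ for $A\in N$ (initially all $0$), a witness table $W[A,u,v]$ (initially all undefined), and a queue $Q$ (initially empty). "Insert $(A,u,v)$ with record $w$" means: if $M_A[u,v]=0$, set $M_A[u,v]\gets 1$, $W[A,u,v]\gets w$, and enqueue $(A,u,v)$; otherwise do nothing. (1) For each production $A\to a$ in $P$ and each edge $(u,v)\in E$ with $\lambda(u,v)=a$, insert $(A,u,v)$ with record $\langle\mathsf{term},(u,v)\rangle$. (2) If $S\to\varepsilon\in P$, for each $u\in V$ insert $(S,u,u)$ with record $\langle\mathsf{eps}\rangle$. (3) While $Q$ is nonempty: dequeue some $(B,x,v)$. For each production of the form $A\to aB$ in $P$ and each $u\in\mathrm{In}_a(x)$, insert $(A,u,v)$ with record $\langle\mathsf{linL},a,(u,x),B\rangle$. For each production of the form $A\to Ba$ in $P$ and each $w\in\mathrm{Out}_a(v)$, insert $(A,x,w)$ with record $\langle\mathsf{linR},B,a,(v,w)\rangle$. Return $\{M_A\}$ and $W$. -}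

module Defs where

open import Level using (0ℓ)
open import Data.Bool using (Bool; true; false; T; if_then_else_)
open import Data.Fin using (Fin)
open import Data.List using (List; []; _∷_; _++_; _∷ʳ_; [_]; map; mapMaybe; length; foldl)
open import Data.List.Membership.Propositional using (_∈_)
open import Data.Maybe using (Maybe; just; nothing)
open import Data.Nat using (ℕ; _≤_)
open import Data.Product using (∃; _×_; _,_)
open import Data.Sum using (_⊎_; inj₁; inj₂; isInj₁)
open import Data.Vec.Functional using (Vector; updateAt)
open import Function using (const; flip; _⇔_)
open import Induction.WellFounded using (Acc)
open import Relation.Binary using (Rel)
open import Relation.Binary.Construct.Closure.ReflexiveTransitive using (Star; ε; _◅_)
open import Relation.Binary.PropositionalEquality using (_≡_)
open import Relation.Unary using (Pred)

-- Finite sets (vertices, nonterminals, the alphabet) are represented by Fin.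
-- The alphabet size σ is a parameter, so that a graph and a grammar can share
-- their alphabet.

record Graph (σ : ℕ) : Set where
  field
    order : ℕ
    edge  : Fin order → Fin order → Bool
    label : ∀ u v → T (edge u v) → Fin σ

  V : Set
  V = Fin order

  Edge : Rel V 0ℓ
  Edge u v = T (edge u v)

  Path : Rel V 0ℓ
  Path = Star Edge

  trace : ∀ {u v} → Path u v → List (Fin σ)
  trace ε                 = []
  trace (_◅_ {u} {v} e π) = label u v e ∷ trace π

  HasLabel : Fin σ → Rel V 0ℓ
  HasLabel a u v = ∃ λ (e : Edge u v) → label u v e ≡ a

  In : Fin σ → V → Pred V 0ℓ
  In a v u = HasLabel a u v

  Out : Fin σ → V → Pred V 0ℓ
  Out a u v = HasLabel a u v

pattern nt A = inj₁ A
pattern tm a = inj₂ a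

record CFG (σ : ℕ) : Set where
  field
    nonterminals : ℕ

  N : Set
  N = Fin nonterminals

  Symbol : Set
  Symbol = N ⊎ Fin σ

  Production : Set
  Production = N × List Symbol

  field
    productions : List Production
    start       : N

  data _⇒_ : Rel (List Symbol) 0ℓ where
    rewriteAt : ∀ α β {A γ} → (A , γ) ∈ productions →
                (α ++ nt A ∷ β) ⇒ (α ++ γ ++ β)

  _⇒*_ : Rel (List Symbol) 0ℓ
  _⇒*_ = Star _⇒_

  Language : N → Pred (List (Fin σ)) 0ℓ
  Language A w = [ nt A ] ⇒* map tm w

  Linear : Set
  Linear = ∀ {A γ} → (A , γ) ∈ productions → length (mapMaybe isInj₁ γ) ≤ 1

  data TALNFProduction : Pred Production 0ℓ where
    A→a  : ∀ {A a}   → TALNFProduction (A , tm a ∷ [])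
    A→aB : ∀ {A a B} → TALNFProduction (A , tm a ∷ nt B ∷ [])
    A→Ba : ∀ {A B a} → TALNFProduction (A , nt B ∷ tm a ∷ [])
    S→ε  : TALNFProduction (start , [])

  TALNF : Set
  TALNF = ∀ {p} → p ∈ productions → TALNFProduction p

module _ {σ : ℕ} (G : Graph σ) (𝒢 : CFG σ) where
  open Graph G
  open CFG 𝒢

  ℛ : N → Rel V 0ℓ
  ℛ A u v = ∃ λ (π : Path u v) → Language A (trace π)

-- The algorithm leaves open which queue element is dequeued and in which order
-- the "for each" loops proceed.  It is therefore modelled as a nondeterministic
-- transition system whose executions comprise all such choices.

module LinIndexBuild {σ : ℕ} (G : Graph σ) (𝒢 : CFG σ) where
  open Graph G
  open CFG 𝒢

  Fact : Set
  Fact = N × V × V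

  data Record : Set where
    term : V × V → Record
    eps  : Record
    linL : Fin σ → V × V → N → Record
    linR : N → Fin σ → V × V → Record

  Table : Set → Set
  Table X = Vector (Vector (Vector X order) order) nonterminals

  _[_]≔_ : ∀ {X} → Table X → Fact → X → Table X
  t [ A , u , v ]≔ x =
    updateAt t A λ rows → updateAt rows u λ row → updateAt row v (const x)

  record State : Set where
    constructor ⟨_,_,_⟩
    field
      M : Table Bool
      W : Table (Maybe Record)
      Q : List Fact

  open State public

  initial : State
  initial = ⟨ (λ _ _ _ → false) , (λ _ _ _ → nothing) , [] ⟩

  Insertion : Set
  Insertion = Fact × Record

  insert : State → Insertion → State
  insert s (f@(A , u , v) , w) =
    if M s A u v
    then s
    else ⟨ M s [ f ]≔ true , W s [ f ]≔ just w , Q s ∷ʳ f ⟩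

  -- Perform the insertions satisfying C one after another, in any order.  The
  -- enumeration xs may repeat an insertion; a repetition has no effect, since
  -- the entry concerned is then already set.
  ForEach : Pred Insertion 0ℓ → Rel State 0ℓ
  ForEach C s s′ = ∃ λ xs → (∀ i → i ∈ xs ⇔ C i) × s′ ≡ foldl insert s xs

  data TermInsertion : Pred Insertion 0ℓ where
    term : ∀ {A a u v} → (A , tm a ∷ []) ∈ productions → HasLabel a u v →
           TermInsertion ((A , u , v) , term (u , v))

  data EpsInsertion : Pred Insertion 0ℓ where
    eps : ∀ {u} → (start , []) ∈ productions →
          EpsInsertion ((start , u , u) , eps)

  data LinLInsertion : Fact → Pred Insertion 0ℓ where
    linL : ∀ {A a B u x v} → (A , tm a ∷ nt B ∷ []) ∈ productions → In a x u →
           LinLInsertion (B , x , v) ((A , u , v) , linL a (u , x) B)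

  data LinRInsertion : Fact → Pred Insertion 0ℓ where
    linR : ∀ {A B a x v w} → (A , nt B ∷ tm a ∷ []) ∈ productions → Out a v w →
           LinRInsertion (B , x , v) ((A , x , w) , linR B a (v , w))

  -- The state on first reaching the while loop.
  Initialised : Pred State 0ℓ
  Initialised s = ∃ λ s₁ → ForEach TermInsertion initial s₁ × ForEach EpsInsertion s₁ s

  -- One iteration of the while loop.
  data _⟶_ : Rel State 0ℓ where
    iterate : ∀ {m w s₁ s₂} pre f post →
              ForEach (LinLInsertion f) ⟨ m , w , pre ++ post ⟩ s₁ →
              ForEach (LinRInsertion f) s₁ s₂ →
              ⟨ m , w , pre ++ f ∷ post ⟩ ⟶ s₂

  -- s is the state at the end of some complete run.
  Final : Pred State 0ℓ
  Final s = ∃ λ s₀ → Initialised s₀ × Star _⟶_ s₀ s × Q s ≡ []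

  -- A complete run exists, and no run continues forever.
  Terminates : Set
  Terminates = ∃ Final × (∀ s₀ → Initialised s₀ → Acc (flip _⟶_) s₀)

-- Both ℛ and the matrices coincide with the least family of facts closed under
-- the insertion rules of the algorithm.  For ℛ, membership of a sentential form
-- in the set of those realised between two vertices is pulled back along each
-- rewriting step, so no derivation ever has to be decomposed.  For the
-- algorithm, every marked fact is derivable, and every marked fact outside the
-- queue has all its consequences marked.  A run terminates because an insertion
-- never increases (unmarked facts + queue length), while dequeuing decreases it.

module Submission where

open import Defs
open import Level using (0ℓ)
open import Data.Bool using (Bool; true; false; if_then_else_)
open import Data.Bool.Properties using (T?; T-irrelevant)
open import Data.Fin using (_≟_)
open import Data.List using (List; []; _∷_; _++_; _∷ʳ_; [_]; map; length; foldl; filter; allFin; cartesianProduct)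
open import Data.List.Membership.Propositional using (_∈_)
open import Data.List.Membership.Propositional.Properties
  using (∈-map⁺; ∈-map⁻; ∈-filter⁺; ∈-filter⁻; ∈-++⁺ˡ; ∈-++⁺ʳ; ∈-++⁻; ∈-allFin; ∈-cartesianProduct⁺)
open import Data.List.Properties using (++-assoc; map-++; length-++; ≡-dec)
open import Data.List.Relation.Binary.Subset.Propositional using (_⊆_)
open import Data.List.Relation.Unary.Any using (here; there)
open import Data.Nat using (ℕ; _+_; _≤_; _<_; z≤n; s≤s)
open import Data.Nat.ListAction using (sum)
open import Data.Nat.Induction using (<-wellFounded)
open import Data.Nat.Properties
  using (≤-refl; ≤-reflexive; ≤-trans; +-mono-≤; +-mono-<-≤; +-mono-≤-<; +-monoˡ-≤; +-suc; +-comm; module ≤-Reasoning)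
open import Data.Product using (∃; _×_; _,_; proj₁; proj₂)
import Data.Product.Properties as Product
open import Data.Sum using (_⊎_; inj₁; inj₂)
import Data.Sum.Properties as Sum
open import Data.Vec.Functional.Properties using (updateAt-updates; updateAt-minimal)
open import Function using (_⇔_; mk⇔; Equivalence; flip; _∘_)
open import Induction.WellFounded using (Acc; acc; WellFounded; module Subrelation)
open import Relation.Binary using (Rel; DecidableEquality)
import Relation.Binary.Construct.On as On
open import Relation.Binary.Construct.Closure.ReflexiveTransitive using (Star; ε; _◅_; _◅◅_; gmap)
open import Relation.Binary.PropositionalEquality using (_≡_; refl; sym; trans; cong; cong-app; subst; subst₂)
open import Relation.Nullary using (Dec; yes; no; _×-dec_)
open import Relation.Nullary.Decidable using (map′)
open import Relation.Unary using (Pred; Decidable)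

-- Sums over lists, list membership and finite enumerations.

sum-map-mono-≤ : ∀ {X : Set} {f g : X → ℕ} → (∀ x → f x ≤ g x) →
                 ∀ xs → sum (map f xs) ≤ sum (map g xs)
sum-map-mono-≤ f≤g []       = z≤n
sum-map-mono-≤ f≤g (x ∷ xs) = +-mono-≤ (f≤g x) (sum-map-mono-≤ f≤g xs)

sum-map-mono-< : ∀ {X : Set} {f g : X → ℕ} → (∀ x → f x ≤ g x) →
                 ∀ {x xs} → x ∈ xs → f x < g x → sum (map f xs) < sum (map g xs)
sum-map-mono-< f≤g {xs = _ ∷ xs} (here refl) fx<gx = +-mono-<-≤ fx<gx (sum-map-mono-≤ f≤g xs)
sum-map-mono-< f≤g {xs = y ∷ _}  (there x∈)  fx<gx = +-mono-≤-< (f≤g y) (sum-map-mono-< f≤g x∈ fx<gx)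

∈-remove : ∀ {X : Set} {x y : X} pre {post} → x ∈ pre ++ y ∷ post → x ≡ y ⊎ x ∈ pre ++ post
∈-remove pre x∈ with ∈-++⁻ pre x∈
... | inj₁ x∈pre          = inj₂ (∈-++⁺ˡ x∈pre)
... | inj₂ (here x≡y)     = inj₁ x≡y
... | inj₂ (there x∈post) = inj₂ (∈-++⁺ʳ pre x∈post)

∈-insert : ∀ {X : Set} {x y : X} pre {post} → x ∈ pre ++ post → x ∈ pre ++ y ∷ post
∈-insert pre x∈ with ∈-++⁻ pre x∈
... | inj₁ x∈pre  = ∈-++⁺ˡ x∈pre
... | inj₂ x∈post = ∈-++⁺ʳ pre (there x∈post)

Enumeration : ∀ {X : Set} → Pred X 0ℓ → Set
Enumeration C = ∃ λ xs → ∀ i → i ∈ xs ⇔ C i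

module _ {X Y : Set} {xs : List X} (all∈ : ∀ x → x ∈ xs) {P : Pred X 0ℓ} (P? : Decidable P) (f : X → Y) where

  -- Provides the lists that `ForEach` asks for: the arguments of a rule range over a finite type,
  -- its side conditions are decidable, and `f` turns admissible arguments into insertions.
  enumerate-image : ∀ {C : Pred Y 0ℓ} → (∀ {x} → P x → C (f x)) →
                    (∀ {y} → C y → ∃ λ x → P x × y ≡ f x) → Enumeration C
  enumerate-image {C} image preimage = map f (filter P? xs) , λ y → mk⇔ to from
    where
    to : ∀ {y} → y ∈ map f (filter P? xs) → C y
    to y∈ with x , x∈ , refl ← ∈-map⁻ f y∈ = image (proj₂ (∈-filter⁻ P? {xs = xs} x∈))

    from : ∀ {y} → C y → y ∈ map f (filter P? xs)
    from c with x , p , refl ← preimage c = ∈-map⁺ f (∈-filter⁺ P? (all∈ x) p)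

-- Edge labels, traces and rewriting in context.

module _ {σ : ℕ} (G : Graph σ) where
  open Graph G

  hasLabel? : ∀ a u v → Dec (HasLabel a u v)
  hasLabel? a u v with T? (edge u v)
  ... | no ¬e = no λ (e , _) → ¬e e
  -- `label` depends on the proof that the edge exists; since `T` is proof-irrelevant, testing the
  -- one proof `e` settles every other.
  ... | yes e = map′ (e ,_) (λ (e′ , eq) → trans (cong (label u v) (T-irrelevant e e′)) eq) (label u v e ≟ a)

  trace-◅◅ : ∀ {u v w} (π : Path u v) (ρ : Path v w) → trace (π ◅◅ ρ) ≡ trace π ++ trace ρ
  trace-◅◅ ε       ρ = refl
  trace-◅◅ (e ◅ π) ρ = cong (_ ∷_) (trace-◅◅ π ρ)

module _ {σ : ℕ} (𝒢 : CFG σ) where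
  open CFG 𝒢

  _≟-production_ : DecidableEquality Production
  _≟-production_ = Product.≡-dec _≟_ (≡-dec (Sum.≡-dec _≟_ _≟_))

  ⇒-∷ : ∀ X {α β} → α ⇒ β → (X ∷ α) ⇒ (X ∷ β)
  ⇒-∷ X (rewriteAt α β p) = rewriteAt (X ∷ α) β p

  ⇒-∷ʳ : ∀ X {α β} → α ⇒ β → (α ∷ʳ X) ⇒ (β ∷ʳ X)
  ⇒-∷ʳ X (rewriteAt α β {A} {γ} p) =
    subst₂ _⇒_ (sym (++-assoc α (nt A ∷ β) [ X ]))
               (sym (trans (++-assoc α (γ ++ β) [ X ]) (cong (α ++_) (++-assoc γ β [ X ]))))
               (rewriteAt α (β ∷ʳ X) p)

  -- The `++ []` comes from the empty right context and computes away at each use, where `γ` is a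
  -- concrete list.
  ⇒-production : ∀ {A γ} → (A , γ) ∈ productions → [ nt A ] ⇒ (γ ++ [])
  ⇒-production = rewriteAt [] []

-- Derivable facts coincide with the relations `ℛ`.

module Correctness {σ : ℕ} (G : Graph σ) (𝒢 : CFG σ) where
  open Graph G
  open CFG 𝒢
  open LinIndexBuild G 𝒢
  open import Data.List.Membership.DecPropositional (_≟-production_ 𝒢) using (_∈?_)

  -- The rules are the insertion predicates themselves, with the record left arbitrary, so that the
  -- constructors can be handed directly to the lemmas about `ForEach`.
  data Derivable : Pred Fact 0ℓ where
    term : ∀ {f r} → TermInsertion (f , r) → Derivable f
    eps  : ∀ {f r} → EpsInsertion (f , r) → Derivable f
    linL : ∀ {f g r} → LinLInsertion g (f , r) → Derivable g → Derivable f
    linR : ∀ {f g r} → LinRInsertion g (f , r) → Derivable g → Derivable f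

  -- Each linear rule prolongs the path by one edge, in front for `linL` and at the end for `linR`,
  -- and runs the inductive derivation beside the new terminal.
  derivable⇒ℛ : ∀ {A u v} → Derivable (A , u , v) → ℛ G 𝒢 A u v
  derivable⇒ℛ (term (term p (e , refl))) = e ◅ ε , ⇒-production 𝒢 p ◅ ε
  derivable⇒ℛ (eps (eps p)) = ε , ⇒-production 𝒢 p ◅ ε
  derivable⇒ℛ (linL (linL {a = a} p (e , refl)) d) with π , B⇒*π ← derivable⇒ℛ d =
    e ◅ π , ⇒-production 𝒢 p ◅ gmap (tm a ∷_) (⇒-∷ 𝒢 (tm a)) B⇒*π
  derivable⇒ℛ (linR (linR {a = a} p (e , refl)) d) with π , B⇒*π ← derivable⇒ℛ d =
    π ◅◅ (e ◅ ε) ,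
    subst (_ ⇒*_) (sym (trans (cong (map tm) (trace-◅◅ G π (e ◅ ε))) (map-++ tm (trace π) [ a ])))
          (⇒-production 𝒢 p ◅ gmap (_∷ʳ tm a) (⇒-∷ʳ 𝒢 (tm a)) B⇒*π)

  Realises : Symbol → Rel V 0ℓ
  Realises (nt A) u v = Derivable (A , u , v)
  Realises (tm a) u v = HasLabel a u v

  -- Relational composition along a sentential form: a terminal contributes its labeled edges, a
  -- nonterminal its derivable facts. Mixed forms get a meaning, so a single rewriting step can be
  -- examined in isolation.
  data Spells : List Symbol → Rel V 0ℓ where
    []  : ∀ {u} → Spells [] u u
    _∷_ : ∀ {X γ u v w} → Realises X u v → Spells γ v w → Spells (X ∷ γ) u w

  spells-++⁻ : ∀ α {β u w} → Spells (α ++ β) u w → ∃ λ v → Spells α u v × Spells β v w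
  spells-++⁻ []      s       = _ , [] , s
  spells-++⁻ (_ ∷ α) (r ∷ s) with v , s₁ , s₂ ← spells-++⁻ α s = v , r ∷ s₁ , s₂

  spells-++⁺ : ∀ {α β u v w} → Spells α u v → Spells β v w → Spells (α ++ β) u w
  spells-++⁺ []       t = t
  spells-++⁺ (r ∷ s)  t = r ∷ spells-++⁺ s t

  spells-trace : ∀ {u v} (π : Path u v) → Spells (map tm (trace π)) u v
  spells-trace ε       = []
  spells-trace (e ◅ π) = (e , refl) ∷ spells-trace π

  module _ (talnf : TALNF) where

    -- This is where the normal form enters: its four production shapes match the four rules of
    -- `Derivable`.
    spells-production : ∀ {A γ u v} → (A , γ) ∈ productions → Spells γ u v → Derivable (A , u , v)
    spells-production p s with talnf p | s
    ... | A→a  | h ∷ []     = term (term p h)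
    ... | A→aB | h ∷ d ∷ [] = linL (linL p h) d
    ... | A→Ba | d ∷ h ∷ [] = linR (linR p h) d
    ... | S→ε  | []         = eps (eps p)

    -- Cut the walk at the two vertices bounding the segment spelled by `γ`, and replace that
    -- segment by the single fact it makes derivable.
    spells-⇒ : ∀ {α β u v} → α ⇒ β → Spells β u v → Spells α u v
    spells-⇒ (rewriteAt α β {γ = γ} p) s
      with _ , s₁ , s₂₃ ← spells-++⁻ α s
      with _ , s₂ , s₃  ← spells-++⁻ γ s₂₃
      = spells-++⁺ s₁ (spells-production p s₂ ∷ s₃)

    spells-⇒* : ∀ {α β u v} → α ⇒* β → Spells β u v → Spells α u v
    spells-⇒* ε        s = s
    spells-⇒* (r ◅ rs) s = spells-⇒ r (spells-⇒* rs s)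

    -- A path spells its own trace edge by edge; pulled back to the start of the derivation, this
    -- spells the one-symbol form `[ nt A ]`, which is a derivable fact.
    ℛ⇒derivable : ∀ {A u v} → ℛ G 𝒢 A u v → Derivable (A , u , v)
    ℛ⇒derivable (π , A⇒*π) with d ∷ [] ← spells-⇒* A⇒*π (spells-trace π) = d

  -- Table updates and the count of unmarked facts.

  infix 4 _⊢_ _⊑_

  _at_ : ∀ {X} → Table X → Fact → X
  t at (A , u , v) = t A u v

  _⊢_ : State → Fact → Set
  s ⊢ f = M s at f ≡ true

  update-at : ∀ {X} (t : Table X) f x → (t [ f ]≔ x) at f ≡ x
  update-at t (A , u , v) x =
    trans (cong (λ rows → rows u v) (updateAt-updates A t))
   (trans (cong-app (updateAt-updates u (t A)) v)
          (updateAt-updates v (t A u)))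

  -- Stated as a disjunction so that one match either unifies the two facts or shows the entry
  -- untouched.
  update-at-other : ∀ {X} (t : Table X) f x g → g ≡ f ⊎ (t [ f ]≔ x) at g ≡ t at g
  update-at-other t (A , u , v) x (A′ , u′ , v′) with A′ ≟ A
  ... | no A′≢A = inj₂ (cong (λ rows → rows u′ v′) (updateAt-minimal A′ A t A′≢A))
  ... | yes refl with u′ ≟ u
  ...   | no u′≢u = inj₂ (trans (cong (λ rows → rows u′ v′) (updateAt-updates A t))
                                (cong-app (updateAt-minimal u′ u (t A) u′≢u) v′))
  ...   | yes refl with v′ ≟ v
  ...     | no v′≢v = inj₂ (trans (cong (λ rows → rows u v′) (updateAt-updates A t))
                           (trans (cong-app (updateAt-updates u (t A)) v′)
                                  (updateAt-minimal v′ v (t A u) v′≢v)))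
  ...     | yes refl = inj₁ refl

  facts : List Fact
  facts = cartesianProduct (allFin _) (cartesianProduct (allFin _) (allFin _))

  ∈-facts : ∀ f → f ∈ facts
  ∈-facts (A , u , v) = ∈-cartesianProduct⁺ (∈-allFin A) (∈-cartesianProduct⁺ (∈-allFin u) (∈-allFin v))

  weight : Bool → ℕ
  weight b = if b then 0 else 1

  unmarked : Table Bool → ℕ
  unmarked m = sum (map (λ f → weight (m at f)) facts)

  -- No summand grows, and the one at `f`, which occurs in `facts`, falls from 1 to 0.
  unmarked-update : ∀ m f → m at f ≡ false → unmarked (m [ f ]≔ true) < unmarked m
  unmarked-update m f mf≡false = sum-map-mono-< weight-mono (∈-facts f) weight-<
    where
    weight-mono : ∀ g → weight ((m [ f ]≔ true) at g) ≤ weight (m at g)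
    weight-mono g with update-at-other m f true g
    ... | inj₁ refl rewrite update-at m f true = z≤n
    ... | inj₂ eq   = ≤-reflexive (cong weight eq)

    weight-< : weight ((m [ f ]≔ true) at f) < weight (m at f)
    weight-< rewrite update-at m f true | mf≡false = s≤s z≤n

  -- The effect of insertions on a state.

  potential : State → ℕ
  potential s = unmarked (M s) + length (Q s)

  -- Collects in one preorder what both correctness and termination need to know about insertions,
  -- so that one induction over a list of insertions serves both.
  record _⊑_ (s s′ : State) : Set where
    field
      marks-mono  : ∀ {f} → s ⊢ f → s′ ⊢ f
      queue-mono  : Q s ⊆ Q s′
      new-queued  : ∀ {f} → s′ ⊢ f → s ⊢ f ⊎ f ∈ Q s′
      potential-≤ : potential s′ ≤ potential s

  open _⊑_

  ⊑-refl : ∀ {s} → s ⊑ s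
  ⊑-refl = record
    { marks-mono = λ m → m ; queue-mono = λ q → q ; new-queued = inj₁ ; potential-≤ = ≤-refl }

  ⊑-trans : ∀ {s t r} → s ⊑ t → t ⊑ r → s ⊑ r
  ⊑-trans {s} {t} {r} p q = record
    { marks-mono  = marks-mono q ∘ marks-mono p
    ; queue-mono  = queue-mono q ∘ queue-mono p
    ; new-queued  = queued
    ; potential-≤ = ≤-trans (potential-≤ q) (potential-≤ p)
    }
    where
    queued : ∀ {f} → r ⊢ f → s ⊢ f ⊎ f ∈ Q r
    queued m with new-queued q m
    ... | inj₂ f∈ = inj₂ f∈
    ... | inj₁ m′ with new-queued p m′
    ...   | inj₁ m″ = inj₁ m″
    -- A fact queued by the first stage is still queued after the second, since insertions never
    -- dequeue.
    ...   | inj₂ f∈ = inj₂ (queue-mono q f∈)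

  ⊑-insert : ∀ s i → s ⊑ insert s i
  ⊑-insert s (f@(A , u , v) , r) with M s A u v in eq
  ... | true  = ⊑-refl
  ... | false = record
    { marks-mono  = λ {g} → mono g
    ; queue-mono  = ∈-++⁺ˡ
    ; new-queued  = λ {g} → queued g
    ; potential-≤ = begin
        unmarked (M s [ f ]≔ true) + length (Q s ∷ʳ f)     ≡⟨ cong (unmarked (M s [ f ]≔ true) +_) (trans (length-++ (Q s)) (+-comm _ 1)) ⟩
        unmarked (M s [ f ]≔ true) + (1 + length (Q s))    ≡⟨ +-suc _ _ ⟩
        -- The new queue entry is paid for by the strict drop in unmarked facts.
        1 + unmarked (M s [ f ]≔ true) + length (Q s)      ≤⟨ +-monoˡ-≤ (length (Q s)) (unmarked-update (M s) f eq) ⟩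
        potential s                                        ∎
    }
    where
    open ≤-Reasoning

    mono : ∀ g → s ⊢ g → (M s [ f ]≔ true) at g ≡ true
    mono g m with update-at-other (M s) f true g
    ... | inj₁ refl = update-at (M s) f true
    ... | inj₂ same = trans same m

    queued : ∀ g → (M s [ f ]≔ true) at g ≡ true → s ⊢ g ⊎ g ∈ Q s ∷ʳ f
    queued g m with update-at-other (M s) f true g
    ... | inj₁ refl = inj₂ (∈-++⁺ʳ (Q s) (here refl))
    ... | inj₂ same = inj₁ (trans (sym same) m)

  insert-marks : ∀ s f r → insert s (f , r) ⊢ f
  insert-marks s f@(A , u , v) r with M s A u v in eq
  ... | true  = eq
  ... | false = update-at (M s) f true

  ⊑-foldl : ∀ s is → s ⊑ foldl insert s is
  ⊑-foldl s []       = ⊑-refl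
  ⊑-foldl s (i ∷ is) = ⊑-trans (⊑-insert s i) (⊑-foldl (insert s i) is)

  foldl-marks : ∀ s {is f r} → (f , r) ∈ is → foldl insert s is ⊢ f
  foldl-marks s {_ ∷ is} (here {x = i} refl) = marks-mono (⊑-foldl (insert s i) is) (insert-marks s _ _)
  foldl-marks s (there i∈)  = foldl-marks (insert s _) i∈

  forEach-⊑ : ∀ {C s s′} → ForEach C s s′ → s ⊑ s′
  forEach-⊑ (is , _ , refl) = ⊑-foldl _ is

  forEach-marks : ∀ {C s s′ f r} → ForEach C s s′ → C (f , r) → s′ ⊢ f
  forEach-marks (_ , is⇔C , refl) c = foldl-marks _ (Equivalence.from (is⇔C _) c)

  -- Soundness: only derivable facts are marked.

  record Sound (s : State) : Set where
    field
      marked-derivable : ∀ {f} → s ⊢ f → Derivable f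
      -- Required separately, because no invariant here records that queued facts are marked.
      queued-derivable : ∀ {f} → f ∈ Q s → Derivable f

  open Sound

  sound-insert : ∀ {s f r} → Derivable f → Sound s → Sound (insert s (f , r))
  sound-insert {s} {f@(A , u , v)} d snd with M s A u v
  ... | true  = snd
  ... | false = record { marked-derivable = λ {g} → marked g ; queued-derivable = queued }
    where
    marked : ∀ g → (M s [ f ]≔ true) at g ≡ true → Derivable g
    marked g m with update-at-other (M s) f true g
    ... | inj₁ refl = d
    ... | inj₂ same = marked-derivable snd (trans (sym same) m)

    queued : ∀ {g} → g ∈ Q s ∷ʳ f → Derivable g
    queued g∈ with ∈-++⁻ (Q s) g∈
    ... | inj₁ g∈Q         = queued-derivable snd g∈Q
    ... | inj₂ (here refl) = d

  sound-foldl : ∀ {s} is → (∀ {f r} → (f , r) ∈ is → Derivable f) → Sound s → Sound (foldl insert s is)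
  sound-foldl []       ds snd = snd
  sound-foldl (i ∷ is) ds snd = sound-foldl is (ds ∘ there) (sound-insert (ds (here refl)) snd)

  sound-forEach : ∀ {C s s′} → ForEach C s s′ → (∀ {f r} → C (f , r) → Derivable f) → Sound s → Sound s′
  sound-forEach (is , is⇔C , refl) ds = sound-foldl is (λ i∈ → ds (Equivalence.to (is⇔C _) i∈))

  sound-initial : Sound initial
  sound-initial = record { marked-derivable = λ () ; queued-derivable = λ () }

  sound-initialised : ∀ {s} → Initialised s → Sound s
  sound-initialised (_ , terms , epses) = sound-forEach epses eps (sound-forEach terms term sound-initial)

  sound-⟶ : ∀ {s s′} → s ⟶ s′ → Sound s → Sound s′
  sound-⟶ (iterate pre f post ls rs) snd =
    sound-forEach rs (λ i → linR i d) (sound-forEach ls (λ i → linL i d) record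
      { marked-derivable = marked-derivable snd
      ; queued-derivable = queued-derivable snd ∘ ∈-insert pre
      })
    -- The dequeued fact is the premise of every insertion in both loops.
    where d = queued-derivable snd (∈-++⁺ʳ pre (here refl))

  -- Completeness: all derivable facts end up marked.

  Processed : State → Fact → Set
  Processed s f = ∀ {g r} → LinLInsertion f (g , r) ⊎ LinRInsertion f (g , r) → s ⊢ g

  -- The worklist invariant: the base rules are already satisfied, and closure under the linear
  -- rules can fail only at facts still waiting in the queue.
  record Saturating (s : State) : Set where
    field
      terms-marked        : ∀ {f r} → TermInsertion (f , r) → s ⊢ f
      eps-marked          : ∀ {f r} → EpsInsertion (f , r) → s ⊢ f
      queued-or-processed : ∀ {f} → s ⊢ f → f ∈ Q s ⊎ Processed s f

  open Saturating

  saturating-initialised : ∀ {s} → Initialised s → Saturating s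
  saturating-initialised {s} (_ , terms , epses) = record
    { terms-marked        = λ i → marks-mono (forEach-⊑ epses) (forEach-marks terms i)
    ; eps-marked          = forEach-marks epses
    ; queued-or-processed = queued
    }
    where
    queued : ∀ {f} → s ⊢ f → f ∈ Q s ⊎ Processed s f
    queued m with new-queued (⊑-trans (forEach-⊑ terms) (forEach-⊑ epses)) m
    -- The other alternative would be a mark in `initial`, where every entry is `false`.
    ... | inj₂ f∈ = inj₁ f∈

  saturating-⟶ : ∀ {s s′} → s ⟶ s′ → Saturating s → Saturating s′
  saturating-⟶ {s} {s′} (iterate pre f post ls rs) sat = record
    { terms-marked        = marks-mono t⊑s′ ∘ terms-marked sat
    ; eps-marked          = marks-mono t⊑s′ ∘ eps-marked sat
    ; queued-or-processed = queued-or-processed′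
    }
    where
    -- The comparison starts just after `f` is dequeued, in a state with the same marks as `s`.
    t⊑s′ = ⊑-trans (forEach-⊑ ls) (forEach-⊑ rs)

    f-processed : Processed s′ f
    f-processed (inj₁ l) = marks-mono (forEach-⊑ rs) (forEach-marks ls l)
    f-processed (inj₂ r) = forEach-marks rs r

    queued-or-processed′ : ∀ {g} → s′ ⊢ g → g ∈ Q s′ ⊎ Processed s′ g
    queued-or-processed′ m with new-queued t⊑s′ m
    ... | inj₂ g∈ = inj₁ g∈
    ... | inj₁ m′ with queued-or-processed sat m′
    ...   | inj₂ processed = inj₂ (marks-mono t⊑s′ ∘ processed)
    ...   | inj₁ g∈ with ∈-remove pre g∈
    ...     | inj₁ refl = inj₂ f-processed
    ...     | inj₂ g∈t  = inj₁ (queue-mono t⊑s′ g∈t)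

  invariant : ∀ {I : Pred State 0ℓ} → (∀ {s s′} → s ⟶ s′ → I s → I s′) →
              ∀ {s s′} → Star _⟶_ s s′ → I s → I s′
  invariant step ε        i = i
  invariant step (r ◅ rs) i = invariant step rs (step r i)

  -- With an empty queue every marked fact is processed, so the marks are closed under all rules and
  -- contain the least such family.
  derivable-marked : ∀ {s} → Saturating s → Q s ≡ [] → ∀ {f} → Derivable f → s ⊢ f
  derivable-marked {s} sat empty = marked
    where
    processed : ∀ {f} → s ⊢ f → Processed s f
    processed m with queued-or-processed sat m
    ... | inj₂ p = p
    ... | inj₁ f∈ with () ← subst (_ ∈_) empty f∈

    marked : ∀ {f} → Derivable f → s ⊢ f
    marked (term i)   = terms-marked sat i
    marked (eps i)    = eps-marked sat i
    marked (linL i d) = processed (marked d) (inj₁ i)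
    marked (linR i d) = processed (marked d) (inj₂ i)

  final-exact : ∀ {s} → Final s → ∀ {f} → s ⊢ f ⇔ Derivable f
  final-exact (_ , init , run , empty) = mk⇔
    (marked-derivable (invariant sound-⟶ run (sound-initialised init)))
    (derivable-marked (invariant saturating-⟶ run (saturating-initialised init)) empty)

  -- Termination of the while loop.

  potential-⟶ : ∀ {s s′} → s ⟶ s′ → potential s′ < potential s
  potential-⟶ {s} {s′} (iterate {m} {w} pre f post ls rs) = begin-strict
    potential s′                              ≤⟨ potential-≤ (⊑-trans (forEach-⊑ ls) (forEach-⊑ rs)) ⟩
    -- The strictness comes from the dequeued entry alone; `x < 1 + x` unfolds to reflexivity of
    -- `≤`.
    unmarked m + length (pre ++ post)         <⟨ ≤-refl ⟩
    1 + unmarked m + length (pre ++ post)     ≡⟨ +-suc (unmarked m) _ ⟨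
    unmarked m + (1 + length (pre ++ post))   ≡⟨ cong (unmarked m +_) dequeued ⟩
    unmarked m + length (pre ++ f ∷ post)     ∎
    where
    open ≤-Reasoning
    dequeued : 1 + length (pre ++ post) ≡ length (pre ++ f ∷ post)
    dequeued = trans (cong (1 +_) (length-++ pre)) (trans (sym (+-suc (length pre) _)) (sym (length-++ pre)))

  ⟶-wellFounded : WellFounded (flip _⟶_)
  ⟶-wellFounded = Subrelation.wellFounded potential-⟶ (On.wellFounded potential <-wellFounded)

  -- Existence of a complete run.

  enumerate-term : Enumeration TermInsertion
  enumerate-term = enumerate-image
    {xs = cartesianProduct (allFin _) (cartesianProduct (allFin _) (cartesianProduct (allFin _) (allFin _)))}
    (λ (A , a , u , v) → ∈-cartesianProduct⁺ (∈-allFin A) (∈-cartesianProduct⁺ (∈-allFin a)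
                           (∈-cartesianProduct⁺ (∈-allFin u) (∈-allFin v))))
    (λ (A , a , u , v) → ((A , tm a ∷ []) ∈? productions) ×-dec hasLabel? G a u v)
    (λ (A , a , u , v) → (A , u , v) , term (u , v))
    (λ (p , h) → term p h)
    (λ { (term p h) → _ , (p , h) , refl })

  enumerate-eps : Enumeration EpsInsertion
  enumerate-eps = enumerate-image ∈-allFin
    (λ _ → (start , []) ∈? productions)
    (λ u → (start , u , u) , eps)
    eps
    (λ { (eps p) → _ , p , refl })

  enumerate-linL : ∀ f → Enumeration (LinLInsertion f)
  enumerate-linL (B , x , v) = enumerate-image
    {xs = cartesianProduct (allFin _) (cartesianProduct (allFin _) (allFin _))}
    (λ (A , a , u) → ∈-cartesianProduct⁺ (∈-allFin A) (∈-cartesianProduct⁺ (∈-allFin a) (∈-allFin u)))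
    (λ (A , a , u) → ((A , tm a ∷ nt B ∷ []) ∈? productions) ×-dec hasLabel? G a u x)
    (λ (A , a , u) → (A , u , v) , linL a (u , x) B)
    (λ (p , h) → linL p h)
    (λ { (linL p h) → _ , (p , h) , refl })

  enumerate-linR : ∀ f → Enumeration (LinRInsertion f)
  enumerate-linR (B , x , v) = enumerate-image
    {xs = cartesianProduct (allFin _) (cartesianProduct (allFin _) (allFin _))}
    (λ (A , a , w) → ∈-cartesianProduct⁺ (∈-allFin A) (∈-cartesianProduct⁺ (∈-allFin a) (∈-allFin w)))
    (λ (A , a , w) → ((A , nt B ∷ tm a ∷ []) ∈? productions) ×-dec hasLabel? G a v w)
    (λ (A , a , w) → (A , x , w) , linR B a (v , w))
    (λ (p , h) → linR p h)
    (λ { (linR p h) → _ , (p , h) , refl })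

  forEach-total : ∀ {C} → Enumeration C → ∀ s → ∃ (ForEach C s)
  forEach-total (is , is⇔C) s = foldl insert s is , is , is⇔C , refl

  initialised : ∃ Initialised
  initialised =
    let s₁ , terms = forEach-total enumerate-term initial
        s₀ , epses = forEach-total enumerate-eps s₁
    in  s₀ , s₁ , terms , epses

  -- Any scheduling yields a witness; this one always dequeues the head, and accessibility justifies
  -- the recursion.
  run-to-empty : ∀ s → Acc (flip _⟶_) s → ∃ λ s′ → Star _⟶_ s s′ × Q s′ ≡ []
  run-to-empty s@(⟨ _ , _ , [] ⟩) _ = s , ε , refl
  run-to-empty ⟨ m , w , f ∷ post ⟩ (acc rec) =
    let s₁ , ls         = forEach-total (enumerate-linL f) ⟨ m , w , post ⟩
        s₂ , rs         = forEach-total (enumerate-linR f) s₁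
        step            = iterate [] f post ls rs
        s′ , run , done = run-to-empty s₂ (rec step)
    in  s′ , step ◅ run , done

  terminates : Terminates
  terminates =
    let s₀ , init      = initialised
        s , run , done = run-to-empty s₀ (⟶-wellFounded s₀)
    in  (s , s₀ , init , run , done) , λ s₀ _ → ⟶-wellFounded s₀

theorem3p5 : ∀ {σ : ℕ} (G : Graph σ) (𝒢 : CFG σ) →
    CFG.Linear 𝒢 → CFG.TALNF 𝒢 →
    let open LinIndexBuild G 𝒢 in
    Terminates ×
    (∀ s → Final s → ∀ A u v → M s A u v ≡ true ⇔ ℛ G 𝒢 A u v)
theorem3p5 G 𝒢 _ talnf = terminates , λ s final A u v → mk⇔
    (derivable⇒ℛ ∘ Equivalence.to (final-exact final))
    (Equivalence.from (final-exact final) ∘ ℛ⇒derivable talnf)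
  where open Correctness G 𝒢
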